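{- Let $G$ be a connected graph of order $n$ and size $m$ (number of edges), and let $\gamma_{\rm esp}=\gamma_{\rm esp}(G)$ be its end super domination number. Then $$m\ge 2(n-\gamma_{\rm esp})-1,$$ with equality if and only if $G$ is a tree and $G\in\mathcal{T}$ (that is, $G$ is a tree having a $2$-coloring with which it belongs to the family $\mathcal{T}$).
   Context: Graphs are finite, simple and undirected. For a graph $G=(V,E)$ and $S\subseteq V$, write $\overline{S}=V\setminus S$, and let $N(v)$ be the open neighbourhood of $v$. A set $S \subseteq V$ is an end super dominating set (ESD-set) of $G$ if for every $u\in\overline{S}$ there exists $v\in S$ with $N(v)\cap\overline{S}=\{u\}$, and moreover $\deg(u)\ge 2$ for every $u\in\overline{S}$. The end super domination number $\gamma_{\rm esp}(G)$ is the minimum cardinality of an ESD-set of $G$. A $2$-coloring of a tree $T$ is an assignment of one of the two colors amber and blue to each vertex of $T$ (no properness is required). The family $\mathcal{T}$ is the family of $2$-colored trees that can be obtained as the last term $T_k$ of a sequence $T_1,\ldots,T_k$, $k\ge 1$, of $2$-colored trees, where $T_1$ is the path $P_4$ with its two leaves colored blue and its two vertices of degree $2$ colored amber, and, if $k\ge 2$, for each $i\in\{1,\ldots,k-1\}$ the $2$-colored tree $T_{i+1}$ is obtained from $T_i$ by one of the following two operations. Operation $\mathcal{O}_1$: add a (vertex-disjoint) path $P_2$ to $T_i$, with one vertex of the added path colored amber and the other blue, and add an edge from the amber vertex of the added path to an amber vertex of $T_i$. Operation $\mathcal{O}_2$: add a (vertex-disjoint) path $P_4$ to $T_i$, with its two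 leaves colored blue and its two vertices of degree $2$ colored amber, and add an edge from a (blue) leaf of the added path to a blue vertex of $T_i$. -}

module Defs where

open import Data.Bool using (Bool; false; T; T?; _∧_; _∨_)
open import Data.Bool.Properties using (∨-comm)
import Data.Bool.Properties as Bool
open import Data.Empty using (⊥-elim)
open import Data.Fin using (Fin; toℕ; splitAt; _<?_) renaming (_≟_ to _≟ᶠ_)
open import Data.Fin.Properties using (all?; any?)
open import Data.Fin.Subset using (Subset; _∈_; _∩_; ∁; ⁅_⁆; ∣_∣; ⊤)
open import Data.Fin.Subset.Properties using (_∈?_; anySubset?; ∣⊤∣≡n; ∈⊤; x∈∁p⇒x∉p)
open import Data.List using (List; _∷_; _++_; [_]; length; filter; allFin; cartesianProduct)
open import Data.List.Relation.Unary.Linked using (Linked)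
open import Data.List.Relation.Unary.Unique.Propositional using (Unique)
open import Data.Nat using (ℕ; zero; suc; _+_; _≤_; z≤n; s≤s; _≟_; _≤?_)
open import Data.Nat.Properties using (1+n≢n)
open import Data.Product using (∃; ∃-syntax; _×_; _,_; proj₁)
open import Data.Sum using (_⊎_; inj₁; inj₂; [_,_]′)
import Data.Vec as Vec
open import Data.Vec using (_∷_; [])
import Data.Vec.Properties as Vec
open import Function using (_∘_)
open import Function.Bundles using (_↔_; Inverse)
open import Relation.Binary.Construct.Closure.ReflexiveTransitive using (Star)
open import Relation.Binary.PropositionalEquality
  using (_≡_; refl; cong₂)
open import Relation.Nullary using (yes; no; does; ¬_)
open import Relation.Nullary.Decidable using (dec-false; _×-dec_; _→-dec_)
open import Relation.Unary using (Decidable)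

-- Finite simple undirected graphs of order n, on the vertex set Fin n.
record Graph (n : ℕ) : Set where
  field
    adj    : Fin n → Fin n → Bool
    sym    : ∀ u v → adj u v ≡ adj v u
    irrefl : ∀ v → adj v v ≡ false

open Graph public using (adj)

Adj : ∀ {n} → Graph n → Fin n → Fin n → Set
Adj G u v = T (adj G u v)

N : ∀ {n} → Graph n → Fin n → Subset n
N G v = Vec.tabulate (adj G v)

deg : ∀ {n} → Graph n → Fin n → ℕ
deg G v = ∣ N G v ∣

-- Each undirected edge is listed once, as the pair (u , v) with u < v.
edges : ∀ {n} → Graph n → List (Fin n × Fin n)
edges {n} G =
  filter (λ (u , v) → (u <? v) ×-dec T? (adj G u v))
         (cartesianProduct (allFin n) (allFin n))

size : ∀ {n} → Graph n → ℕ
size G = length (edges G)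

-- The graph on no vertices does not count as connected.
Connected : ∀ {n} → Graph n → Set
Connected {n} G = 1 ≤ n × (∀ u v → Star (Adj G) u v)

-- A cycle v , vs₁ , … , vsₖ , v has k ≥ 2 and v , vs₁ , … , vsₖ distinct.
IsCycle : ∀ {n} → Graph n → Fin n → List (Fin n) → Set
IsCycle G v vs =
  2 ≤ length vs × Unique (v ∷ vs) × Linked (Adj G) (v ∷ vs ++ [ v ])

IsTree : ∀ {n} → Graph n → Set
IsTree G = Connected G × (∀ v vs → ¬ IsCycle G v vs)

IsESD : ∀ {n} → Graph n → Subset n → Set
IsESD G S = ∀ u → u ∈ ∁ S →
  (∃[ v ] (v ∈ S × N G v ∩ ∁ S ≡ ⁅ u ⁆)) × 2 ≤ deg G u

isESD? : ∀ {n} (G : Graph n) → Decidable (IsESD G)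
isESD? G S = all? λ u → (u ∈? ∁ S) →-dec
  (any? (λ v → (v ∈? S) ×-dec Vec.≡-dec Bool._≟_ (N G v ∩ ∁ S) ⁅ u ⁆)
    ×-dec (2 ≤? deg G u))

IsMinimum : (ℕ → Set) → ℕ → Set
IsMinimum P k = P k × (∀ j → P j → k ≤ j)

minimum : ∀ {P : ℕ → Set} → Decidable P → ∀ b → P b → ∃ (IsMinimum P)
minimum P? b pb with P? 0
... | yes p0 = 0 , p0 , λ _ _ → z≤n
minimum P? zero pb    | no ¬p0 = ⊥-elim (¬p0 pb)
minimum P? (suc b) pb | no ¬p0 with minimum (P? ∘ suc) b pb
... | k , pk , least = suc k , pk ,
  λ { zero p0 → ⊥-elim (¬p0 p0) ; (suc j) pj → s≤s (least j pj) }

HasESDOfSize : ∀ {n} → Graph n → ℕ → Set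
HasESDOfSize G k = ∃[ S ] (IsESD G S × ∣ S ∣ ≡ k)

-- A minimum exists because the whole vertex set is an ESD-set.
minESD : ∀ {n} (G : Graph n) → ∃ (IsMinimum (HasESDOfSize G))
minESD {n} G = minimum
  (λ k → anySubset? λ S → isESD? G S ×-dec (∣ S ∣ ≟ k))
  n
  (⊤ , (λ u u∈∁⊤ → ⊥-elim (x∈∁p⇒x∉p u∈∁⊤ ∈⊤)) , ∣⊤∣≡n n)

γesp : ∀ {n} → Graph n → ℕ
γesp G = proj₁ (minESD G)

data Colour : Set where
  amber blue : Colour

Colouring : ℕ → Set
Colouring n = Fin n → Colour

path : ∀ n → Graph n
path n = record
  { adj    = λ u v → next u v ∨ next v u
  ; sym    = λ u v → ∨-comm (next u v) (next v u)
  ; irrefl = λ v → let eq = dec-false (suc (toℕ v) ≟ toℕ v) 1+n≢n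
                   in cong₂ _∨_ eq eq
  }
  where
  next : Fin n → Fin n → Bool
  next u v = does (suc (toℕ u) ≟ toℕ v)

-- The disjoint union of G and H together with one edge joining x in G to
-- y in H; the vertices of G come first in Fin (n + k).
join : ∀ {n k} → Graph n → Fin n → Graph k → Fin k → Graph (n + k)
join {n} {k} G x H y = record
  { adj    = λ u v → adj⊎ (splitAt n u) (splitAt n v)
  ; sym    = λ u v → sym⊎ (splitAt n u) (splitAt n v)
  ; irrefl = λ v → irrefl⊎ (splitAt n v)
  }
  where
  adj⊎ : Fin n ⊎ Fin k → Fin n ⊎ Fin k → Bool
  adj⊎ (inj₁ u) (inj₁ v) = adj G u v
  adj⊎ (inj₂ u) (inj₂ v) = adj H u v
  adj⊎ (inj₁ u) (inj₂ v) = does (u ≟ᶠ x) ∧ does (v ≟ᶠ y)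
  adj⊎ (inj₂ v) (inj₁ u) = does (u ≟ᶠ x) ∧ does (v ≟ᶠ y)

  sym⊎ : ∀ a b → adj⊎ a b ≡ adj⊎ b a
  sym⊎ (inj₁ u) (inj₁ v) = Graph.sym G u v
  sym⊎ (inj₂ u) (inj₂ v) = Graph.sym H u v
  sym⊎ (inj₁ _) (inj₂ _) = refl
  sym⊎ (inj₂ _) (inj₁ _) = refl

  irrefl⊎ : ∀ a → adj⊎ a a ≡ false
  irrefl⊎ (inj₁ v) = Graph.irrefl G v
  irrefl⊎ (inj₂ v) = Graph.irrefl H v

_⊕_ : ∀ {n k} → Colouring n → Colouring k → Colouring (n + k)
_⊕_ {n} c d = [ c , d ]′ ∘ splitAt n

record Iso {n k} (G : Graph n) (c : Colouring n)
                 (H : Graph k) (d : Colouring k) : Set where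
  field
    bijection        : Fin n ↔ Fin k
  open Inverse bijection using (to)
  field
    preserves-adj    : ∀ u v → adj G u v ≡ adj H (to u) (to v)
    preserves-colour : ∀ v → c v ≡ d (to v)

colour₂ : Colouring 2
colour₂ = Vec.lookup (amber ∷ blue ∷ [])

colour₄ : Colouring 4
colour₄ = Vec.lookup (blue ∷ amber ∷ amber ∷ blue ∷ [])

-- In O₁ and O₂ the vertex y is the end of the new edge in the added path.
-- The family is closed under colour-preserving isomorphism.
data 𝒯 : ∀ {n} → Graph n → Colouring n → Set where
  base : 𝒯 (path 4) colour₄

  O₁ : ∀ {n} {G : Graph n} {c : Colouring n} (x : Fin n) (y : Fin 2) →
       c x ≡ amber → colour₂ y ≡ amber →
       𝒯 G c → 𝒯 (join G x (path 2) y) (c ⊕ colour₂)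

  O₂ : ∀ {n} {G : Graph n} {c : Colouring n} (x : Fin n) (y : Fin 4) →
       c x ≡ blue → colour₄ y ≡ blue →
       𝒯 G c → 𝒯 (join G x (path 4) y) (c ⊕ colour₄)

  iso : ∀ {n k} {G : Graph n} {c : Colouring n}
        {H : Graph k} {d : Colouring k} →
        Iso G c H d → 𝒯 G c → 𝒯 H d

{-# OPTIONS --safe #-}

-- Let S be an ESD-set.  Double counting the pairs (v , u) with v ∈ S and
-- N(v) ∩ ∁S = {u} gives ∣∁S∣ ≤ ∣S∣, that is n ≤ 2γ, while a connected graph has
-- m ≥ n − 1; the bound is the sum of these two inequalities.
--
-- If it is attained, then G is a tree and n = 2γ, so the edges between S (blue)
-- and ∁S (amber) form a perfect matching, and every amber vertex has an amber
-- neighbour.  Such a colouring of any connected graph admits a spanning subgraph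
-- in 𝒯: start with the P₄ around an amber edge, and while some vertex w is
-- missed, choose it adjacent to a covered vertex x.  Covered vertices have
-- covered mates, so x and w have the same colour.  If both are amber, O₁ adds w
-- and its mate.  If both are blue, let a be the mate of w and z an amber
-- neighbour of a; O₁ adds {a , w} through the edge za if z is covered, and
-- otherwise O₂ adds w , a , z and the mate of z.  As m = n − 1, this spanning
-- subgraph is all of G.
--
-- Conversely, the operations preserve the matching property, whence the blue
-- vertices of a graph in 𝒯 form an ESD-set of size n/2.
module Submission where

open import Defs
open import Data.Bool using (Bool; true; false; T; T?; _∧_; _∨_; not; if_then_else_)
import Data.Bool.Properties as Bool
open import Data.Bool.Properties using (T-∧; T-≡; ∧-comm; ∨-comm; ∧-zeroʳ)
open import Data.Fin as Fin using (Fin; zero; suc; splitAt; _↑ˡ_; _↑ʳ_; punchIn; punchOut)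
open import Data.Fin.Patterns using (0F; 1F; 2F; 3F)
open import Data.Fin.Properties as Fin
  using (any?; all?; ¬∀⟶∃¬; injective⇒≤; punchInᵢ≢i; punchIn-punchOut; punchOut-injective;
         splitAt-↑ˡ; splitAt-↑ʳ; splitAt⁻¹-↑ˡ; splitAt⁻¹-↑ʳ)
open import Data.Fin.Subset using (Subset; _∈_; _∩_; ∁; ⁅_⁆; ∣_∣)
open import Data.Fin.Subset.Properties
  using (_∈?_; x∈∁p⇒x∉p; x∉p⇒x∈∁p; x∈p∩q⁺; x∈p∩q⁻; x∈⁅x⁆; x∈⁅y⁆⇒x≡y; ⊆-antisym)
open import Data.List as List using ([]; _∷_; _++_; [_]; length; filter; map; cartesianProduct)
open import Data.List.Properties using (length-++; filter-++)
open import Data.List.Relation.Unary.All using (All; []; _∷_)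
open import Data.List.Relation.Unary.AllPairs using ([]; _∷_)
open import Data.List.Relation.Unary.Linked using (Linked; _∷_)
open import Data.Nat as ℕ using (ℕ; zero; suc; _+_; _≤_; _<_; z≤n; s≤s; s≤s⁻¹)
open import Data.Nat.Properties as ℕ
open import Data.Nat.Tactic.RingSolver using (solve-∀)
open import Data.Product using (∃-syntax; Σ; _×_; _,_; proj₁; proj₂)
open import Data.Sum using (_⊎_; inj₁; inj₂; [_,_]′)
open import Data.Unit using (tt)
import Data.Vec as Vec
open import Data.Vec using ([]; _∷_)
import Data.Vec.Properties as Vec
open import Function using (_∘_; id; case_of_)
open import Function.Bundles using (_⇔_; Equivalence; Inverse; mk⇔; mk↔ₛ′)
open import Function.Definitions using (Injective)
open import Level using (0ℓ)
open import Relation.Binary.Construct.Closure.ReflexiveTransitive using (Star; ε; _◅_; _⋆; reverse)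
open import Relation.Binary.Definitions using (tri<; tri≈; tri>)
open import Relation.Binary.PropositionalEquality
  using (_≡_; _≢_; refl; sym; trans; cong; cong₂; subst; subst₂; _≗_; module ≡-Reasoning)
open import Relation.Nullary using (¬_; Dec; yes; no; does; contradiction)
open import Relation.Nullary.Decidable
  using (_×-dec_; _⊎-dec_; _→-dec_; ¬?; map′; toWitness; dec-true; dec-false)
open import Relation.Unary using (Pred; Decidable)
open import Algebra.Properties.CommutativeMonoid.Sum ℕ.+-0-commutativeMonoid
  using (sum; sum-remove; sum-cong-≗; ∑-distrib-+; ∑-comm; sum-replicate-zero)

-- Indicators, finite sums and counting.

does⇒ : ∀ {P : Set} (P? : Dec P) → T (does P?) → P
does⇒ (yes p) _ = p

𝟙 : Bool → ℕ
𝟙 b = if b then 1 else 0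

𝟙-T : ∀ {b} → T b → 𝟙 b ≡ 1
𝟙-T {true} _ = refl

𝟙-mono : ∀ {a b} → (T a → T b) → 𝟙 a ≤ 𝟙 b
𝟙-mono {false}        _ = z≤n
𝟙-mono {true} {true}  _ = ≤-refl
𝟙-mono {true} {false} h = contradiction (h tt) λ ()

𝟙-injective : ∀ {a b} → 𝟙 a ≡ 𝟙 b → a ≡ b
𝟙-injective {false} {false} _ = refl
𝟙-injective {true}  {true}  _ = refl

sum-mono-≤ : ∀ {n} {f g : Fin n → ℕ} → (∀ i → f i ≤ g i) → sum f ≤ sum g
sum-mono-≤ {zero}  _ = z≤n
sum-mono-≤ {suc n} h = +-mono-≤ (h zero) (sum-mono-≤ (h ∘ suc))

-- The gaps between `g` and `f` are nonnegative and add up to at most zero. Every equality case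
-- below is extracted from a chain of inequalities by this lemma.
sum-tight : ∀ {n} {f g : Fin n → ℕ} → (∀ i → f i ≤ g i) → sum g ≤ sum f → f ≗ g
sum-tight {suc n} {f} {g} f≤g Σg≤Σf = λ
  { zero    → ≤-antisym (f≤g zero)
      (+-cancelʳ-≤ (sum (g ∘ suc)) _ _ (≤-trans Σg≤Σf (+-monoʳ-≤ (f zero) tail≤)))
  ; (suc i) → sum-tight (f≤g ∘ suc)
      (+-cancelˡ-≤ (g zero) _ _ (≤-trans Σg≤Σf (+-monoˡ-≤ _ (f≤g zero)))) i
  }
  where
  tail≤ : sum (f ∘ suc) ≤ sum (g ∘ suc)
  tail≤ = sum-mono-≤ (f≤g ∘ suc)

-- Once the term at `f zero` is split off, the other values of `f` avoid `f zero`, so `punchOut`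
-- turns them into an injection into a codomain smaller by one.
sum-injection : ∀ {k n} {f : Fin k → Fin n} → Injective _≡_ _≡_ f →
                (g : Fin n → ℕ) → sum (g ∘ f) ≤ sum g
sum-injection {zero}          _   g = z≤n
sum-injection {suc k} {zero}  {f} _ g with () ← f zero
sum-injection {suc k} {suc n} {f} inj g = begin
  g (f zero) + sum (g ∘ f ∘ suc)
    ≡⟨ cong (g (f zero) +_) (sum-cong-≗ λ i → cong g (sym (punchIn-punchOut (f0≢ i)))) ⟩
  g (f zero) + sum (g ∘ punchIn (f zero) ∘ λ i → punchOut (f0≢ i))
    ≤⟨ +-monoʳ-≤ (g (f zero)) (sum-injection
         (λ eq → Fin.suc-injective (inj (punchOut-injective (f0≢ _) (f0≢ _) eq)))
         (g ∘ punchIn (f zero))) ⟩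
  g (f zero) + sum (g ∘ punchIn (f zero))
    ≡⟨ sum-remove {i = f zero} g ⟨
  sum g ∎
  where
  open ≤-Reasoning
  f0≢ : ∀ i → f zero ≢ f (suc i)
  f0≢ i eq with () ← inj eq

sum-splitAt : ∀ n {k} (g : Fin (n + k) → ℕ) →
              sum g ≡ sum (λ i → g (i ↑ˡ k)) + sum (λ j → g (n ↑ʳ j))
sum-splitAt zero    g = refl
sum-splitAt (suc n) g =
  trans (cong (g zero +_) (sum-splitAt n (g ∘ suc))) (sym (+-assoc (g zero) _ _))

count : ∀ {n} → (Fin n → Bool) → ℕ
count p = sum (𝟙 ∘ p)

count>0⇒∃ : ∀ {n} (p : Fin n → Bool) → 1 ≤ count p → ∃[ x ] T (p x)
count>0⇒∃ {suc n} p h with p zero in eq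
... | true  = zero , subst T (sym eq) tt
... | false with x , px ← count>0⇒∃ (p ∘ suc) h = suc x , px

-- Deleting position `w` lowers the count by at most one, so a witness remains in the range of
-- `punchIn w`.
count>1⇒∃≢ : ∀ {n} (p : Fin n → Bool) → 2 ≤ count p → ∀ w → ∃[ x ] (x ≢ w × T (p x))
count>1⇒∃≢ {suc n} p h w with
  x , px ← count>0⇒∃ (p ∘ punchIn w) (s≤s⁻¹ (≤-trans h (≤-trans
             (≤-reflexive (sum-remove {i = w} (𝟙 ∘ p))) (+-monoˡ-≤ _ (𝟙-mono {p w} {true} _)))))
  = punchIn w x , punchInᵢ≢i w x , px

∃⇒count>0 : ∀ {n} (p : Fin n → Bool) {x} → T (p x) → 1 ≤ count p
∃⇒count>0 p {x} px =
  subst (_≤ count p) (cong (_+ 0) (𝟙-T px))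
    (sum-injection {k = 1} {f = λ _ → x} (λ { {zero} {zero} _ → refl }) (𝟙 ∘ p))

∃≢⇒count>1 : ∀ {n} (p : Fin n → Bool) {x y} → x ≢ y → T (p x) → T (p y) → 2 ≤ count p
∃≢⇒count>1 p {x} {y} x≢y px py =
  subst (_≤ count p) (cong₂ (λ a b → a + (b + 0)) (𝟙-T px) (𝟙-T py))
    (sum-injection {k = 2} {f = Vec.lookup (x ∷ y ∷ [])} inj (𝟙 ∘ p))
  where
  inj : Injective _≡_ _≡_ (Vec.lookup (x ∷ y ∷ []))
  inj {zero}     {zero}     _  = refl
  inj {zero}     {suc zero} eq = contradiction eq x≢y
  inj {suc zero} {zero}     eq = contradiction (sym eq) x≢y
  inj {suc zero} {suc zero} _  = refl

count≤1 : ∀ {n} (p : Fin n → Bool) → (∀ {x y} → T (p x) → T (p y) → x ≡ y) → count p ≤ 1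
count≤1 p uniq = ≮⇒≥ λ h →
  let x , px     = count>0⇒∃ p (<⇒≤ h)
      y , y≢x , py = count>1⇒∃≢ p h x
  in y≢x (uniq py px)

count-≟ : ∀ {n} (x : Fin n) → count (λ y → does (y Fin.≟ x)) ≡ 1
count-≟ x = ≤-antisym
  (count≤1 _ λ {y} {z} hy hz → trans (does⇒ (y Fin.≟ x) hy) (sym (does⇒ (z Fin.≟ x) hz)))
  (∃⇒count>0 (λ y → does (y Fin.≟ x)) {x} (subst T (sym (dec-true (x Fin.≟ x) refl)) tt))

-- Degree sums.

degreeSum : ∀ {n} → Graph n → ℕ
degreeSum G = sum λ u → count (adj G u)

length-filter-map : ∀ {n} {A B : Set} {P : Pred B 0ℓ} (P? : Decidable P) (f : A → B) (g : Fin n → A) →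
  length (filter P? (map f (List.tabulate g))) ≡ count (λ i → does (P? (f (g i))))
length-filter-map {zero}  P? f g = refl
length-filter-map {suc n} P? f g with does (P? (f (g zero)))
... | true  = cong suc (length-filter-map P? f (g ∘ suc))
... | false = length-filter-map P? f (g ∘ suc)

length-filter-cartesianProduct :
  ∀ {m n} {A B : Set} {P : Pred (A × B) 0ℓ} (P? : Decidable P) (f : Fin m → A) (g : Fin n → B) →
  length (filter P? (cartesianProduct (List.tabulate f) (List.tabulate g))) ≡
  sum (λ i → count (λ j → does (P? (f i , g j))))
length-filter-cartesianProduct {zero}  P? f g = refl
length-filter-cartesianProduct {suc m} P? f g = begin
  length (filter P? (row ++ rest))           ≡⟨ cong length (filter-++ P? row rest) ⟩
  length (filter P? row ++ filter P? rest)   ≡⟨ length-++ (filter P? row) ⟩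
  length (filter P? row) + length (filter P? rest)
    ≡⟨ cong₂ _+_ (length-filter-map P? (f zero ,_) g)
                 (length-filter-cartesianProduct P? (f ∘ suc) g) ⟩
  sum (λ i → count (λ j → does (P? (f i , g j)))) ∎
  where
  open ≡-Reasoning
  row  = map (f zero ,_) (List.tabulate g)
  rest = cartesianProduct (List.tabulate (f ∘ suc)) (List.tabulate g)

-- Each adjacency is charged to its ascending orientation `asc`; exchanging the two summations shows
-- that the descending half has the same total. Edge counts are henceforth kept as degree sums,
-- because embeddings need not respect the order `u < v` on which `edges` relies.
degreeSum≡2size : ∀ {n} (G : Graph n) → degreeSum G ≡ size G + size G
degreeSum≡2size {n} G = begin
  sum (λ u → count (adj G u))
    ≡⟨ sum-cong-≗ (λ u → sum-cong-≗ (split u)) ⟩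
  sum (λ u → sum (λ v → 𝟙 (asc u v) + 𝟙 (asc v u)))
    ≡⟨ sum-cong-≗ (λ u → ∑-distrib-+ (𝟙 ∘ asc u) (λ v → 𝟙 (asc v u))) ⟩
  sum (λ u → count (asc u) + sum (λ v → 𝟙 (asc v u)))
    ≡⟨ ∑-distrib-+ (λ u → count (asc u)) _ ⟩
  S + sum (λ u → sum (λ v → 𝟙 (asc v u)))
    ≡⟨ cong (S +_) (∑-comm (λ u v → 𝟙 (asc v u))) ⟩
  S + S
    ≡⟨ cong₂ _+_ S≡size S≡size ⟩
  size G + size G ∎
  where
  open ≡-Reasoning
  asc : Fin n → Fin n → Bool
  asc u v = does ((u Fin.<? v) ×-dec T? (adj G u v))
  S = sum (λ u → count (asc u))
  S≡size : S ≡ size G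
  S≡size = sym (length-filter-cartesianProduct
    (λ (u , v) → (u Fin.<? v) ×-dec T? (adj G u v)) id id)
  split : ∀ u v → 𝟙 (adj G u v) ≡ 𝟙 (asc u v) + 𝟙 (asc v u)
  split u v with Fin.<-cmp u v
  ... | tri< u<v _ v≮u rewrite dec-true (u Fin.<? v) u<v | dec-false (v Fin.<? u) v≮u =
    sym (+-identityʳ _)
  ... | tri≈ u≮v refl _ rewrite dec-false (u Fin.<? u) u≮v = cong 𝟙 (Graph.irrefl G u)
  ... | tri> u≮v _ v<u rewrite dec-true (v Fin.<? u) v<u | dec-false (u Fin.<? v) u≮v =
    cong 𝟙 (Graph.sym G u v)

-- Splitting rows and columns at `n` gives four blocks: the two diagonal ones are the degree sums of
-- `G` and `H`, and each off-diagonal one has a single entry 1, for one direction of the new edge.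
degreeSum-join : ∀ {n k} (G : Graph n) x (H : Graph k) y →
                 degreeSum (join G x H y) ≡ degreeSum G + degreeSum H + 2
degreeSum-join {n} {k} G x H y = begin
  sum (λ u → count (adj J u))
    ≡⟨ sum-splitAt n (λ u → count (adj J u)) ⟩
  sum (λ u → count (adj J (u ↑ˡ k))) + sum (λ u → count (adj J (n ↑ʳ u)))
    ≡⟨ cong₂ _+_ (sum-cong-≗ rowˡ) (sum-cong-≗ rowʳ) ⟩
  sum (λ u → count (adj G u) + count (λ v → x≟ u ∧ y≟ v)) +
  sum (λ u → count (λ v → x≟ v ∧ y≟ u) + count (adj H u))
    ≡⟨ cong₂ _+_ (∑-distrib-+ (λ u → count (adj G u)) _)
                 (∑-distrib-+ (λ u → count (λ v → x≟ v ∧ y≟ u)) _) ⟩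
  (degreeSum G + sum (λ u → count (λ v → x≟ u ∧ y≟ v))) +
  (sum (λ u → count (λ v → x≟ v ∧ y≟ u)) + degreeSum H)
    ≡⟨ cong₂ (λ a b → (degreeSum G + a) + (b + degreeSum H)) one
         (trans (∑-comm (λ u v → 𝟙 (x≟ v ∧ y≟ u))) one) ⟩
  (degreeSum G + 1) + (1 + degreeSum H)
    ≡⟨ arith (degreeSum G) (degreeSum H) ⟩
  degreeSum G + degreeSum H + 2 ∎
  where
  open ≡-Reasoning
  J = join G x H y
  x≟ : Fin n → Bool
  x≟ u = does (u Fin.≟ x)
  y≟ : Fin k → Bool
  y≟ v = does (v Fin.≟ y)
  arith : ∀ a b → (a + 1) + (1 + b) ≡ a + b + 2
  arith = solve-∀
  one : sum (λ u → count (λ v → x≟ u ∧ y≟ v)) ≡ 1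
  one = trans (sum-cong-≗ inner) (count-≟ x)
    where
    inner : ∀ u → count (λ v → x≟ u ∧ y≟ v) ≡ 𝟙 (x≟ u)
    inner u with x≟ u
    ... | true  = count-≟ y
    ... | false = sum-replicate-zero k
  rowˡ : ∀ u → count (adj J (u ↑ˡ k)) ≡ count (adj G u) + count (λ v → x≟ u ∧ y≟ v)
  rowˡ u = trans (sum-splitAt n (𝟙 ∘ adj J (u ↑ˡ k)))
    (cong₂ _+_ (sum-cong-≗ λ v → cong 𝟙 (join-adjˡˡ u v))
               (sum-cong-≗ λ v → cong 𝟙 (join-adjˡʳ u v)))
    where
    join-adjˡˡ : ∀ u v → adj J (u ↑ˡ k) (v ↑ˡ k) ≡ adj G u v
    join-adjˡˡ u v rewrite splitAt-↑ˡ n u k | splitAt-↑ˡ n v k = refl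
    join-adjˡʳ : ∀ u v → adj J (u ↑ˡ k) (n ↑ʳ v) ≡ (x≟ u ∧ y≟ v)
    join-adjˡʳ u v rewrite splitAt-↑ˡ n u k | splitAt-↑ʳ n k v = refl
  rowʳ : ∀ u → count (adj J (n ↑ʳ u)) ≡ count (λ v → x≟ v ∧ y≟ u) + count (adj H u)
  rowʳ u = trans (sum-splitAt n (𝟙 ∘ adj J (n ↑ʳ u)))
    (cong₂ _+_ (sum-cong-≗ λ v → cong 𝟙 (join-adjʳˡ u v))
               (sum-cong-≗ λ v → cong 𝟙 (join-adjʳʳ u v)))
    where
    join-adjʳˡ : ∀ u v → adj J (n ↑ʳ u) (v ↑ˡ k) ≡ (x≟ v ∧ y≟ u)
    join-adjʳˡ u v rewrite splitAt-↑ˡ n v k | splitAt-↑ʳ n k u = refl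
    join-adjʳʳ : ∀ u v → adj J (n ↑ʳ u) (n ↑ʳ v) ≡ adj H u v
    join-adjʳʳ u v rewrite splitAt-↑ʳ n k u | splitAt-↑ʳ n k v = refl

-- Embeddings: subgraphs that need not be induced.

record Embedding {k n} (H : Graph k) (G : Graph n) : Set where
  field
    to        : Fin k → Fin n
    injective : Injective _≡_ _≡_ to
    hom       : ∀ {u v} → Adj H u v → Adj G (to u) (to v)

open Embedding

Covers : ∀ {k n} {H : Graph k} {G : Graph n} → Embedding H G → Fin n → Set
Covers e w = ∃[ x ] to e x ≡ w

covers? : ∀ {k n} {H : Graph k} {G : Graph n} (e : Embedding H G) → Decidable (Covers e)
covers? e w = any? λ x → to e x Fin.≟ w

covers-all⇒n≤k : ∀ {k n} {H : Graph k} {G : Graph n} (e : Embedding H G) →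
                 (∀ w → Covers e w) → n ≤ k
covers-all⇒n≤k e cov = injective⇒≤ {f = proj₁ ∘ cov} λ {v} {w} eq →
  trans (sym (proj₂ (cov v))) (trans (cong (to e) eq) (proj₂ (cov w)))

Adj-sym : ∀ {n} (G : Graph n) {u v} → Adj G u v → Adj G v u
Adj-sym G {u} {v} = subst T (Graph.sym G u v)

Adj-irrefl : ∀ {n} (G : Graph n) {v} → ¬ Adj G v v
Adj-irrefl G {v} = subst T (Graph.irrefl G v)

joinEmbedding : ∀ {k l n} {H : Graph k} {K : Graph l} {G : Graph n}
  (e : Embedding H G) (f : Embedding K G) → (∀ j → ¬ Covers e (to f j)) →
  ∀ x y → Adj G (to e x) (to f y) → Embedding (join H x K y) G
joinEmbedding {k} {l} {n} {H} {K} {G} e f disjoint x y edge = record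
  { to        = [ to e , to f ]′ ∘ splitAt k
  ; injective = inj
  ; hom       = λ {u} {v} → joinHom u v
  }
  where
  inj : Injective _≡_ _≡_ ([ to e , to f ]′ ∘ splitAt k)
  inj {u} {v} eq with splitAt k u in p | splitAt k v in q
  ... | inj₁ a | inj₁ b = trans (sym (splitAt⁻¹-↑ˡ p))
    (trans (cong (_↑ˡ l) (injective e eq)) (splitAt⁻¹-↑ˡ q))
  ... | inj₁ a | inj₂ b = contradiction (a , eq) (disjoint b)
  ... | inj₂ a | inj₁ b = contradiction (b , sym eq) (disjoint a)
  ... | inj₂ a | inj₂ b = trans (sym (splitAt⁻¹-↑ʳ p))
    (trans (cong (k ↑ʳ_) (injective f eq)) (splitAt⁻¹-↑ʳ q))

  edge′ : ∀ u v → T (does (u Fin.≟ x) ∧ does (v Fin.≟ y)) → Adj G (to e u) (to f v)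
  edge′ u v h with yes refl ← u Fin.≟ x | yes refl ← v Fin.≟ y = edge

  joinHom : ∀ u v → Adj (join H x K y) u v →
            Adj G ([ to e , to f ]′ (splitAt k u)) ([ to e , to f ]′ (splitAt k v))
  joinHom u v h with splitAt k u | splitAt k v
  ... | inj₁ a | inj₁ b = hom e h
  ... | inj₁ a | inj₂ b = edge′ a b h
  ... | inj₂ a | inj₁ b = Adj-sym G (edge′ b a h)
  ... | inj₂ a | inj₂ b = hom f h

module _ {k n} {H : Graph k} {G : Graph n} (e : Embedding H G) where

  private
    along : Fin k → Fin k → Bool
    along u v = adj G (to e u) (to e v)

    adj≤along : ∀ u v → 𝟙 (adj H u v) ≤ 𝟙 (along u v)
    adj≤along u v = 𝟙-mono (hom e)

    along≤ : sum (λ u → count (along u)) ≤ degreeSum G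
    along≤ = ≤-trans
      (sum-mono-≤ λ u → sum-injection (injective e) (𝟙 ∘ adj G (to e u)))
      (sum-injection (injective e) (count ∘ adj G))

  degreeSum-mono : degreeSum H ≤ degreeSum G
  degreeSum-mono = ≤-trans (sum-mono-≤ λ u → sum-mono-≤ (adj≤along u)) along≤

  -- The chain behind `degreeSum-mono` collapses to equalities, and `sum-tight` is applied twice,
  -- first to rows and then to entries. A subgraph with as many edges as `G` is therefore induced.
  degreeSum-tight : degreeSum G ≤ degreeSum H →
                    ∀ u v → adj H u v ≡ adj G (to e u) (to e v)
  degreeSum-tight G≤H u v = 𝟙-injective (sum-tight (adj≤along u) (≤-reflexive (sym row)) v)
    where
    row : count (adj H u) ≡ count (along u)
    row = sum-tight (λ u → sum-mono-≤ (adj≤along u)) (≤-trans along≤ G≤H) u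

-- Growing a spanning subgraph.

crossing : ∀ {n} {R : Fin n → Fin n → Set} {P : Pred (Fin n) 0ℓ} → Decidable P →
           ∀ {u w} → Star R u w → P u → ¬ P w → ∃[ a ] ∃[ b ] (P a × ¬ P b × R a b)
crossing P? ε pu ¬pw = contradiction pu ¬pw
crossing P? {u} (_◅_ {j = v} r rs) pu ¬pw with P? v
... | yes pv = crossing P? rs pv ¬pw
... | no ¬pv = u , v , pu , ¬pv , r

module _ {n} (G : Graph n) (P : ∀ {k} (H : Graph k) → Embedding H G → Set) where

  -- `P` is an invariant of embedded subgraphs. The larger subgraph is only required to have more
  -- vertices; it need not contain `w` or extend the old one.
  Grows : Set
  Grows = ∀ {k} {H : Graph k} (e : Embedding H G) → P H e →
    ∀ x w → Adj G (to e x) w → ¬ Covers e w →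
    ∃[ l ] (k < l × ∃[ H′ ] Σ (Embedding {l} H′ G) (P H′))

  -- A walk from a covered to an uncovered vertex has an edge leaving the covered set, to which
  -- `Grows` applies. Orders increase strictly and are bounded by `n`, so `n` units of fuel suffice.
  -- The argument in `Fin k` supplies the start of the walk.
  spanning : Connected G → Grows →
    ∀ {k} {H : Graph k} (e : Embedding H G) → Fin k → P H e →
    ∃[ l ] ∃[ H′ ] Σ (Embedding {l} H′ G) λ e′ → P H′ e′ × ∀ w → Covers e′ w
  spanning (_ , conn) grows {k₀} e₀ x₀ p₀ = go n e₀ x₀ p₀ (m≤n+m n k₀)
    where
    go : ∀ fuel {k} {H : Graph k} (e : Embedding H G) → Fin k → P H e → n ≤ k + fuel →
         ∃[ l ] ∃[ H′ ] Σ (Embedding {l} H′ G) λ e′ → P H′ e′ × ∀ w → Covers e′ w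
    go fuel {k} {H} e x p n≤ with all? (covers? e)
    ... | yes cov = k , H , e , p , cov
    ... | no ¬cov with ¬∀⟶∃¬ n (Covers e) (covers? e) ¬cov
    ... | w , ¬w with crossing (covers? e) (conn (to e x) w) (x , refl) ¬w
    ... | _ , b , (a , refl) , ¬b , ab with grows e p a b ab ¬b
    -- Without fuel `n ≤ k`, yet `e′` injects more than `k` vertices into `Fin n`.
    go zero {k} e x p n≤ | no _ | _ | _ | l , k<l , _ , e′ , _ =
      contradiction (≤-trans k<l (≤-trans (injective⇒≤ (injective e′)) n≤))
        (λ h → <-irrefl refl (subst (k <_) (+-identityʳ k) h))
    go (suc fuel) {k} e x p n≤ | no _ | _ | _ | l , k<l , _ , e′ , p′ =
      go fuel e′ (Fin.fromℕ< (≤-trans (s≤s z≤n) k<l)) p′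
        (≤-trans n≤ (≤-trans (≤-reflexive (+-suc k fuel)) (+-monoˡ-≤ fuel k<l)))

point : ∀ {n} {G : Graph n} → Fin n → Embedding (path 1) G
point v = record
  { to        = λ _ → v
  ; injective = λ { {zero} {zero} _ → refl }
  ; hom       = λ { {zero} {zero} () }
  }

-- This is `m ≥ n - 1`, doubled and freed of subtraction. A tree is grown from one vertex by joining
-- single vertices; each step adds one vertex and one edge, which preserves
-- `degreeSum H + 2 ≡ k + k`.
connected⇒2n≤degreeSum+2 : ∀ {n} (G : Graph n) → Connected G → n + n ≤ degreeSum G + 2
connected⇒2n≤degreeSum+2 {zero}  G _ = z≤n
connected⇒2n≤degreeSum+2 {suc n} G conn
  with spanning G (λ {k} H _ → degreeSum H + 2 ≡ k + k) conn grows (point zero) zero refl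
  where
  arith : ∀ d k → d + 2 ≡ k + k → d + 0 + 2 + 2 ≡ (k + 1) + (k + 1)
  arith d k eq = trans (cong (λ z → z + 2 + 2) (+-identityʳ d)) (trans (cong (_+ 2) eq) (lem k))
    where
    lem : ∀ k → k + k + 2 ≡ (k + 1) + (k + 1)
    lem = solve-∀
  grows : Grows G (λ {k} H _ → degreeSum H + 2 ≡ k + k)
  grows {k} {H} e eq x w xw ¬w =
    k + 1 , ≤-reflexive (+-comm 1 k) , join H x (path 1) zero ,
    joinEmbedding e (point w) (λ _ → ¬w) x zero xw ,
    trans (cong (_+ 2) (degreeSum-join H x (path 1) zero)) (arith (degreeSum H) k eq)
... | l , H , e , eq , cov = ≤-trans (+-mono-≤ n≤l n≤l)
  (≤-trans (≤-reflexive (sym eq)) (+-monoˡ-≤ 2 (degreeSum-mono e)))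
  where n≤l = covers-all⇒n≤k e cov

-- Edge deletion and acyclicity.

module _ {n} (G : Graph n) (a b : Fin n) where

  private
    ab? : ∀ u v → Dec ((u ≡ a × v ≡ b) ⊎ (u ≡ b × v ≡ a))
    ab? u v = (u Fin.≟ a ×-dec v Fin.≟ b) ⊎-dec (u Fin.≟ b ×-dec v Fin.≟ a)

  deleteEdge : Graph n
  deleteEdge = record
    { adj    = λ u v → adj G u v ∧ not (does (ab? u v))
    ; sym    = λ u v → cong₂ _∧_ (Graph.sym G u v) (cong not (trans
        (∨-comm (does (u Fin.≟ a) ∧ does (v Fin.≟ b)) _)
        (cong₂ _∨_ (∧-comm (does (u Fin.≟ b)) _) (∧-comm (does (u Fin.≟ a)) _))))
    ; irrefl = λ v → cong (_∧ not (does (ab? v v))) (Graph.irrefl G v)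
    }

  deleteEdge-intro : ∀ {u v} → Adj G u v → ¬ (u ≡ a × v ≡ b) → ¬ (u ≡ b × v ≡ a) →
                     Adj deleteEdge u v
  deleteEdge-intro {u} {v} uv ¬ab ¬ba rewrite dec-false (ab? u v) [ ¬ab , ¬ba ]′ =
    Equivalence.from T-∧ (uv , tt)

  deleteEdge-embedding : Embedding deleteEdge G
  deleteEdge-embedding = record
    { to        = id
    ; injective = id
    ; hom       = λ h → proj₁ (Equivalence.to T-∧ h)
    }

  deleteEdge-deletes : adj deleteEdge a b ≡ false
  deleteEdge-deletes rewrite dec-true (ab? a b) (inj₁ (refl , refl)) = ∧-zeroʳ (adj G a b)

  -- In any walk, each use of the deleted edge is replaced by the detour or its reversal.
  deleteEdge-connected : Connected G → Star (Adj deleteEdge) a b → Connected deleteEdge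
  deleteEdge-connected (1≤n , conn) detour = 1≤n , λ u v → (step ⋆) (conn u v)
    where
    step : ∀ {u v} → Adj G u v → Star (Adj deleteEdge) u v
    step {u} {v} uv with ab? u v
    ... | yes (inj₁ (refl , refl)) = detour
    ... | yes (inj₂ (refl , refl)) = reverse (Adj-sym deleteEdge) detour
    ... | no ¬ab = deleteEdge-intro uv (¬ab ∘ inj₁) (¬ab ∘ inj₂) ◅ ε

  -- A walk that never visits `b` cannot use the deleted edge. It will be the part of a cycle that
  -- follows `b` and closes at `a`.
  avoiding-walk : a ≢ b → ∀ x xs → Linked (Adj G) (x ∷ xs ++ [ a ]) → b ≢ x → All (b ≢_) xs →
                  Star (Adj deleteEdge) x a
  avoiding-walk a≢b x [] (xa ∷ _) b≢x [] =
    deleteEdge-intro xa (λ (_ , a≡b) → a≢b a≡b) (λ (x≡b , _) → b≢x (sym x≡b)) ◅ ε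
  avoiding-walk a≢b x (y ∷ ys) (xy ∷ link) b≢x (b≢y ∷ b≢ys) =
    deleteEdge-intro xy (λ (_ , y≡b) → b≢y (sym y≡b)) (λ (x≡b , _) → b≢x (sym x≡b)) ◅
    avoiding-walk a≢b y ys link b≢y b≢ys

-- The first edge of a cycle can be deleted without disconnecting the graph.
minimal-size⇒acyclic : ∀ {n} (G : Graph n) → Connected G → degreeSum G + 2 ≤ n + n →
                       ∀ v vs → ¬ IsCycle G v vs
minimal-size⇒acyclic G conn tight a (b ∷ [])     (s≤s () , _)
minimal-size⇒acyclic G conn tight a (b ∷ d ∷ vs)
  (_ , ((a≢b ∷ a≢d ∷ _) ∷ (b≢d ∷ b≢vs) ∷ _) , (ab ∷ bd ∷ link)) =
  subst T (trans (sym adj≡) (deleteEdge-deletes G a b)) ab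
  where
  G′ = deleteEdge G a b
  detour : Star (Adj G′) a b
  detour = reverse (Adj-sym G′)
    (deleteEdge-intro G a b bd (λ (b≡a , _) → a≢b (sym b≡a)) (λ (_ , d≡a) → a≢d (sym d≡a)) ◅
     avoiding-walk G a b a≢b d vs link b≢d b≢vs)
  -- `G′` is still connected, so the lower bound on its degree sum reaches that of `G`, and the
  -- identity embedding of `G′` in `G` is tight.
  adj≡ : adj G′ a b ≡ adj G a b
  adj≡ = degreeSum-tight (deleteEdge-embedding G a b)
    (+-cancelʳ-≤ 2 _ _ (≤-trans tight
      (connected⇒2n≤degreeSum+2 G′ (deleteEdge-connected G a b conn detour))))
    a b

-- Colourings whose bicoloured edges form a perfect matching.

_≟ᶜ_ : (x y : Colour) → Dec (x ≡ y)
amber ≟ᶜ amber = yes refl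
amber ≟ᶜ blue  = no λ ()
blue  ≟ᶜ amber = no λ ()
blue  ≟ᶜ blue  = yes refl

isBlue : Colour → Bool
isBlue amber = false
isBlue blue  = true

BiAdj : ∀ {n} → Graph n → Colouring n → Fin n → Fin n → Set
BiAdj G c u v = Adj G u v × c u ≢ c v

BiAdj-sym : ∀ {n} (G : Graph n) (c : Colouring n) {u v} → BiAdj G c u v → BiAdj G c v u
BiAdj-sym G c (uv , c≢) = Adj-sym G uv , c≢ ∘ sym

record BiMatching {n} (G : Graph n) (c : Colouring n) : Set where
  field
    mate   : ∀ u → ∃[ v ] BiAdj G c u v
    unique : ∀ u v w → BiAdj G c u v → BiAdj G c u w → v ≡ w

AmberNeighbours : ∀ {n} → Graph n → Colouring n → Set
AmberNeighbours G c = ∀ u → c u ≡ amber → ∃[ z ] (c z ≡ amber × Adj G u z)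

-- The colouring form of an ESD-set with half of the vertices, coloured blue: `Matched⇒ESD` and
-- `ESD⇒Matched` translate between the two.
record Matched {n} (G : Graph n) (c : Colouring n) : Set where
  field
    biMatching      : BiMatching G c
    amberNeighbours : AmberNeighbours G c
  open BiMatching biMatching public

  μ : Fin n → Fin n
  μ = proj₁ ∘ mate

  μ-adj : ∀ u → BiAdj G c u (μ u)
  μ-adj = proj₂ ∘ mate

  μ-unique : ∀ {u v} → BiAdj G c u v → v ≡ μ u
  μ-unique {u} {v} uv = unique u v (μ u) uv (μ-adj u)

  μ-involutive : ∀ u → u ≡ μ (μ u)
  μ-involutive u = μ-unique (BiAdj-sym G c (μ-adj u))

  μ-injective : Injective _≡_ _≡_ μ
  μ-injective {u} {v} eq = trans (μ-involutive u) (trans (cong μ eq) (sym (μ-involutive v)))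

biAdj? : ∀ {n} (G : Graph n) c u v → Dec (BiAdj G c u v)
biAdj? G c u v = T? (adj G u v) ×-dec ¬? (c u ≟ᶜ c v)

-- Decidability allows the matching property of the two added paths to be checked by evaluation.
biMatching? : ∀ {n} (G : Graph n) c → Dec (BiMatching G c)
biMatching? G c = map′
  (λ (m , u) → record { mate = m ; unique = u })
  (λ M → BiMatching.mate M , BiMatching.unique M)
  ((all? λ u → any? λ v → biAdj? G c u v) ×-dec
   (all? λ u → all? λ v → all? λ w →
     biAdj? G c u v →-dec (biAdj? G c u w →-dec (v Fin.≟ w))))

amberNeighbours? : ∀ {n} (G : Graph n) c → Dec (AmberNeighbours G c)
amberNeighbours? G c = all? λ u → (c u ≟ᶜ amber) →-dec
  any? λ z → (c z ≟ᶜ amber) ×-dec T? (adj G u z)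

-- Joins and isomorphisms.

fromEitherSide : ∀ n {k} (u : Fin (n + k)) →
                     (∃[ a ] a ↑ˡ k ≡ u) ⊎ (∃[ b ] n ↑ʳ b ≡ u)
fromEitherSide n u with splitAt n u in eq
... | inj₁ a = inj₁ (a , splitAt⁻¹-↑ˡ eq)
... | inj₂ b = inj₂ (b , splitAt⁻¹-↑ʳ eq)

module _ {n k} (G : Graph n) (x : Fin n) (H : Graph k) (y : Fin k)
         (c : Colouring n) (d : Colouring k) where

  private
    J = join G x H y
    e = c ⊕ d

  ⊕-↑ˡ : ∀ u → e (u ↑ˡ k) ≡ c u
  ⊕-↑ˡ u = cong [ c , d ]′ (splitAt-↑ˡ n u k)

  ⊕-↑ʳ : ∀ v → e (n ↑ʳ v) ≡ d v
  ⊕-↑ʳ v = cong [ c , d ]′ (splitAt-↑ʳ n k v)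

  join-Adjˡ : ∀ {u v} → Adj G u v → Adj J (u ↑ˡ k) (v ↑ˡ k)
  join-Adjˡ {u} {v} h rewrite splitAt-↑ˡ n u k | splitAt-↑ˡ n v k = h

  join-Adjʳ : ∀ {u v} → Adj H u v → Adj J (n ↑ʳ u) (n ↑ʳ v)
  join-Adjʳ {u} {v} h rewrite splitAt-↑ʳ n k u | splitAt-↑ʳ n k v = h

  join-Adj-new : Adj J (x ↑ˡ k) (n ↑ʳ y)
  join-Adj-new rewrite splitAt-↑ˡ n x k | splitAt-↑ʳ n k y
    | dec-true (x Fin.≟ x) refl | dec-true (y Fin.≟ y) refl = tt

  -- The new edge has ends of equal colour, so the bicoloured edges of the join are exactly those of
  -- the two parts.
  join-biMatching : c x ≡ d y → BiMatching G c → BiMatching H d → BiMatching J e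
  join-biMatching cx≡dy M M′ = record { mate = mate ; unique = unique }
    where
    mate : ∀ u → ∃[ v ] BiAdj J e u v
    mate u with fromEitherSide n u
    ... | inj₁ (a , refl) with b , ab , c≢ ← BiMatching.mate M a =
      b ↑ˡ k , join-Adjˡ ab , λ h → c≢ (trans (sym (⊕-↑ˡ a)) (trans h (⊕-↑ˡ b)))
    ... | inj₂ (a , refl) with b , ab , c≢ ← BiMatching.mate M′ a =
      n ↑ʳ b , join-Adjʳ ab , λ h → c≢ (trans (sym (⊕-↑ʳ a)) (trans h (⊕-↑ʳ b)))
    ¬cross : ∀ {a b} → T (does (a Fin.≟ x) ∧ does (b Fin.≟ y)) → c a ≡ d b
    ¬cross {a} {b} h with yes refl ← a Fin.≟ x | yes refl ← b Fin.≟ y = cx≡dy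
    unique : ∀ u v w → BiAdj J e u v → BiAdj J e u w → v ≡ w
    unique u v w (uv , cv) (uw , cw) with splitAt n u | splitAt n v in p | splitAt n w in q
    ... | inj₁ a | inj₂ b | _      = contradiction (¬cross uv) cv
    ... | inj₂ a | inj₁ b | _      = contradiction (sym (¬cross uv)) cv
    ... | inj₁ a | inj₁ _ | inj₂ b = contradiction (¬cross uw) cw
    ... | inj₂ a | inj₂ _ | inj₁ b = contradiction (sym (¬cross uw)) cw
    ... | inj₁ a | inj₁ b | inj₁ b′ = trans (sym (splitAt⁻¹-↑ˡ p))
      (trans (cong (_↑ˡ k) (BiMatching.unique M a b b′ (uv , cv) (uw , cw))) (splitAt⁻¹-↑ˡ q))
    ... | inj₂ a | inj₂ b | inj₂ b′ = trans (sym (splitAt⁻¹-↑ʳ p))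
      (trans (cong (n ↑ʳ_) (BiMatching.unique M′ a b b′ (uv , cv) (uw , cw))) (splitAt⁻¹-↑ʳ q))

  -- The first alternative lets an amber vertex of the added path use the new edge, since `path 2`
  -- has no amber edge of its own; for `path 4` the second alternative is enough.
  join-amberNeighbours : AmberNeighbours G c →
    (∀ v → d v ≡ amber →
      (v ≡ y × c x ≡ amber) ⊎ ∃[ z ] (d z ≡ amber × Adj H v z)) →
    AmberNeighbours J e
  join-amberNeighbours A A′ u eu with fromEitherSide n u
  ... | inj₁ (a , refl) with z , cz , az ← A a (trans (sym (⊕-↑ˡ a)) eu) =
    z ↑ˡ k , trans (⊕-↑ˡ z) cz , join-Adjˡ az
  ... | inj₂ (b , refl) with A′ b (trans (sym (⊕-↑ʳ b)) eu)
  ... | inj₁ (refl , cx)   = x ↑ˡ k , trans (⊕-↑ˡ x) cx , Adj-sym J join-Adj-new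
  ... | inj₂ (z , dz , bz) = n ↑ʳ z , trans (⊕-↑ʳ z) dz , join-Adjʳ bz

biMatching₂ : BiMatching (path 2) colour₂
biMatching₂ = toWitness {a? = biMatching? (path 2) colour₂} tt

biMatching₄ : BiMatching (path 4) colour₄
biMatching₄ = toWitness {a? = biMatching? (path 4) colour₄} tt

amberNeighbours₄ : AmberNeighbours (path 4) colour₄
amberNeighbours₄ = toWitness {a? = amberNeighbours? (path 4) colour₄} tt

module _ {n k} {G : Graph n} {c : Colouring n} {H : Graph k} {d : Colouring k}
         (i : Iso G c H d) where

  open Inverse (Iso.bijection i) using (strictlyInverseˡ; strictlyInverseʳ)
    renaming (to to to′; from to from′)

  private
    to-injective : Injective _≡_ _≡_ to′
    to-injective {u} {v} eq =
      trans (sym (strictlyInverseʳ u)) (trans (cong from′ eq) (strictlyInverseʳ v))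

    from-injective : Injective _≡_ _≡_ from′
    from-injective {u} {v} eq =
      trans (sym (strictlyInverseˡ u)) (trans (cong to′ eq) (strictlyInverseˡ v))

    from-adj : ∀ u v → adj G (from′ u) (from′ v) ≡ adj H u v
    from-adj u v = trans (Iso.preserves-adj i (from′ u) (from′ v))
      (cong₂ (adj H) (strictlyInverseˡ u) (strictlyInverseˡ v))

    from-colour : ∀ v → c (from′ v) ≡ d v
    from-colour v = trans (Iso.preserves-colour i (from′ v)) (cong d (strictlyInverseˡ v))

    from-BiAdj : ∀ {u v} → BiAdj H d u v → BiAdj G c (from′ u) (from′ v)
    from-BiAdj {u} {v} (uv , d≢) =
      subst T (sym (from-adj u v)) uv ,
      λ eq → d≢ (trans (sym (from-colour u)) (trans eq (from-colour v)))

    to-Adj : ∀ {u v} → Adj G (from′ u) v → Adj H u (to′ v)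
    to-Adj {u} {v} h = subst T
      (trans (cong (adj G (from′ u)) (sym (strictlyInverseʳ v))) (from-adj u (to′ v))) h

  iso-Matched : Matched G c → Matched H d
  iso-Matched M = record
    { biMatching = record
      { mate   = λ u → let v , uv , c≢ = Matched.mate M (from′ u) in
          to′ v , to-Adj uv ,
          λ eq → c≢ (trans (from-colour u) (trans eq (sym (Iso.preserves-colour i v))))
      ; unique = λ u v w uv uw → from-injective
          (Matched.unique M _ _ _ (from-BiAdj uv) (from-BiAdj uw))
      }
    ; amberNeighbours = λ u du →
        let z , cz , uz = Matched.amberNeighbours M (from′ u) (trans (from-colour u) du)
        in to′ z , trans (sym (Iso.preserves-colour i z)) cz , to-Adj uz
    }

  iso-order : n ≡ k
  iso-order = ≤-antisym (injective⇒≤ to-injective) (injective⇒≤ from-injective)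

  iso-degreeSum : degreeSum G ≡ degreeSum H
  iso-degreeSum = ≤-antisym
    (degreeSum-mono {H = G} {G = H} record
      { to = to′ ; injective = to-injective
      ; hom = λ {u} {v} → subst T (Iso.preserves-adj i u v) })
    (degreeSum-mono {H = H} {G = G} record
      { to = from′ ; injective = from-injective
      ; hom = λ {u} {v} → subst T (sym (from-adj u v)) })

-- Invariants of the family `𝒯`.

𝒯⇒Matched : ∀ {n} {G : Graph n} {c : Colouring n} → 𝒯 G c → Matched G c
𝒯⇒Matched base = record { biMatching = biMatching₄ ; amberNeighbours = amberNeighbours₄ }
𝒯⇒Matched (O₁ {G = G} {c} x y cx dy t) = record
  { biMatching      = join-biMatching G x (path 2) y c colour₂ (trans cx (sym dy))
                        (Matched.biMatching M) biMatching₂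
  ; amberNeighbours = join-amberNeighbours G x (path 2) y c colour₂ (Matched.amberNeighbours M)
                        -- The only amber vertex of the added path is the end of the new edge, so
                        -- its amber neighbour is `x`.
                        λ v dv → inj₁ (amber₂ v y dv dy , cx)
  }
  where
  M = 𝒯⇒Matched t
  amber₂ : ∀ u v → colour₂ u ≡ amber → colour₂ v ≡ amber → u ≡ v
  amber₂ zero zero _ _ = refl
  amber₂ zero (suc zero) _ ()
  amber₂ (suc zero) _ () _
𝒯⇒Matched (O₂ {G = G} {c} x y cx dy t) = record
  { biMatching      = join-biMatching G x (path 4) y c colour₄ (trans cx (sym dy))
                        (Matched.biMatching M) biMatching₄
  ; amberNeighbours = join-amberNeighbours G x (path 4) y c colour₄ (Matched.amberNeighbours M)
                        λ v dv → inj₂ (amberNeighbours₄ v dv)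
  }
  where M = 𝒯⇒Matched t
𝒯⇒Matched (iso i t) = iso-Matched i (𝒯⇒Matched t)

-- Each operation adds as many edges as vertices, two or four. The degree sums 2 and 6 of the added
-- paths are found by evaluation.
𝒯⇒degreeSum+2≡2n : ∀ {n} {G : Graph n} {c : Colouring n} → 𝒯 G c → degreeSum G + 2 ≡ n + n
𝒯⇒degreeSum+2≡2n base = refl
𝒯⇒degreeSum+2≡2n (O₁ {n} {G} x y _ _ t) =
  trans (cong (_+ 2) (degreeSum-join G x (path 2) y))
    (trans (lem₁ (degreeSum G)) (trans (cong (_+ 4) (𝒯⇒degreeSum+2≡2n t)) (lem₂ n)))
  where
  lem₁ : ∀ a → a + 2 + 2 + 2 ≡ a + 2 + 4
  lem₁ = solve-∀
  lem₂ : ∀ n → n + n + 4 ≡ (n + 2) + (n + 2)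
  lem₂ = solve-∀
𝒯⇒degreeSum+2≡2n (O₂ {n} {G} x y _ _ t) =
  trans (cong (_+ 2) (degreeSum-join G x (path 4) y))
    (trans (lem₁ (degreeSum G)) (trans (cong (_+ 8) (𝒯⇒degreeSum+2≡2n t)) (lem₂ n)))
  where
  lem₁ : ∀ a → a + 6 + 2 + 2 ≡ a + 2 + 8
  lem₁ = solve-∀
  lem₂ : ∀ n → n + n + 8 ≡ (n + 4) + (n + 4)
  lem₂ = solve-∀
𝒯⇒degreeSum+2≡2n (iso {n} {k} i t) =
  trans (cong (_+ 2) (sym (iso-degreeSum i)))
    (trans (𝒯⇒degreeSum+2≡2n t) (cong (λ m → m + m) (iso-order i)))

-- ESD-sets from matched colourings.

count+count-not : ∀ {n} (p : Fin n → Bool) → count p + count (not ∘ p) ≡ n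
count+count-not {zero}  p = refl
count+count-not {suc n} p with p zero
... | true  = cong suc (count+count-not (p ∘ suc))
... | false = trans (+-suc _ _) (cong suc (count+count-not (p ∘ suc)))

∣p∣≡count : ∀ {n} (p : Subset n) → ∣ p ∣ ≡ count (Vec.lookup p)
∣p∣≡count []          = refl
∣p∣≡count (true ∷ p)  = cong suc (∣p∣≡count p)
∣p∣≡count (false ∷ p) = ∣p∣≡count p

∣tabulate∣≡count : ∀ {n} (p : Fin n → Bool) → ∣ Vec.tabulate p ∣ ≡ count p
∣tabulate∣≡count p = trans (∣p∣≡count (Vec.tabulate p))
  (sum-cong-≗ λ i → cong 𝟙 (Vec.lookup∘tabulate p i))

∈⇒T : ∀ {n} {p : Subset n} {x} → x ∈ p → T (Vec.lookup p x)
∈⇒T x∈p = Equivalence.from T-≡ (Vec.[]=⇒lookup x∈p)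

T⇒∈ : ∀ {n} {p : Subset n} {x} → T (Vec.lookup p x) → x ∈ p
T⇒∈ {x = x} h = Vec.lookup⇒[]= x _ (Equivalence.to T-≡ h)

∈-tabulate⁺ : ∀ {n} {p : Fin n → Bool} {x} → T (p x) → x ∈ Vec.tabulate p
∈-tabulate⁺ {p = p} {x} = T⇒∈ ∘ subst T (sym (Vec.lookup∘tabulate p x))

∈-tabulate⁻ : ∀ {n} {p : Fin n → Bool} {x} → x ∈ Vec.tabulate p → T (p x)
∈-tabulate⁻ {p = p} {x} = subst T (Vec.lookup∘tabulate p x) ∘ ∈⇒T

colourOf : Bool → Colour
colourOf b = if b then blue else amber

module _ {n} {G : Graph n} {c : Colouring n} (M : Matched G c) where
  open Matched M

  private
    blue? : Fin n → Bool
    blue? = isBlue ∘ c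

    blueSet : Subset n
    blueSet = Vec.tabulate blue?

    blue⇒amber-mate : ∀ v → T (blue? v) → T (not (blue? (μ v)))
    blue⇒amber-mate v h with c v | c (μ v) | proj₂ (μ-adj v)
    ... | blue  | amber | _  = tt
    ... | blue  | blue  | c≢ = contradiction refl c≢

    amber-mate-blue : ∀ {v} → c v ≡ amber → T (blue? (μ v))
    amber-mate-blue {v} cv with c (μ v) | proj₂ (μ-adj v)
    ... | blue  | _  = tt
    ... | amber | c≢ = contradiction cv c≢

    ∈∁⇒amber : ∀ {v} → v ∈ ∁ blueSet → c v ≡ amber
    ∈∁⇒amber {v} h with c v in cv
    ... | amber = refl
    ... | blue  = contradiction (∈-tabulate⁺ (subst (T ∘ isBlue) (sym cv) tt)) (x∈∁p⇒x∉p h)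

  -- The blue vertices are taken. Mates inject them into the amber ones, hence `k + k ≤ n`. An amber
  -- `u` is the only amber neighbour of its blue mate, and this mate together with an amber
  -- neighbour gives `u` degree at least 2.
  Matched⇒ESD : ∃[ k ] (k + k ≤ n × HasESDOfSize G k)
  Matched⇒ESD = ∣ blueSet ∣ , small , blueSet , isESD , refl
    where
    small : ∣ blueSet ∣ + ∣ blueSet ∣ ≤ n
    small = begin
      ∣ blueSet ∣ + ∣ blueSet ∣ ≡⟨ cong₂ _+_ (∣tabulate∣≡count blue?) (∣tabulate∣≡count blue?) ⟩
      count blue? + count blue?
        ≤⟨ +-monoʳ-≤ (count blue?) (≤-trans (sum-mono-≤ λ v → 𝟙-mono (blue⇒amber-mate v))
             (sum-injection μ-injective (𝟙 ∘ not ∘ blue?))) ⟩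
      count blue? + count (not ∘ blue?) ≡⟨ count+count-not blue? ⟩
      n ∎
      where open ≤-Reasoning
    isESD : IsESD G blueSet
    isESD u u∈∁ = (μ u , ∈-tabulate⁺ (amber-mate-blue cu) , ⊆-antisym ⊆ˡ ⊆ʳ) , 2≤deg
      where
      cu = ∈∁⇒amber u∈∁
      z = amberNeighbours u cu
      ⊆ˡ : ∀ {w} → w ∈ N G (μ u) ∩ ∁ blueSet → w ∈ ⁅ u ⁆
      ⊆ˡ {w} h with w∈N , w∈∁ ← x∈p∩q⁻ (N G (μ u)) (∁ blueSet) h =
        subst (_∈ ⁅ u ⁆) (unique (μ u) u w (BiAdj-sym G c (μ-adj u))
          (∈-tabulate⁻ w∈N , λ eq → subst (T ∘ isBlue) (trans eq (∈∁⇒amber w∈∁)) (amber-mate-blue cu)))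
          (x∈⁅x⁆ u)
      ⊆ʳ : ∀ {w} → w ∈ ⁅ u ⁆ → w ∈ N G (μ u) ∩ ∁ blueSet
      ⊆ʳ h with refl ← x∈⁅y⁆⇒x≡y u h =
        x∈p∩q⁺ (∈-tabulate⁺ (Adj-sym G (proj₁ (μ-adj u))) , u∈∁)
      2≤deg : 2 ≤ deg G u
      2≤deg = subst (2 ≤_) (sym (∣tabulate∣≡count (adj G u)))
        (∃≢⇒count>1 (adj G u)
          (λ eq → proj₂ (μ-adj u) (trans cu (trans (sym (proj₁ (proj₂ z))) (cong c (sym eq)))))
          (proj₁ (μ-adj u)) (proj₂ (proj₂ z)))

-- Double counting for ESD-sets.

module _ {n} {G : Graph n} {S : Subset n} (esd : IsESD G S) where

  private
    inS : Fin n → Bool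
    inS = Vec.lookup S

    Dominates : Fin n → Fin n → Set
    Dominates v u = v ∈ S × N G v ∩ ∁ S ≡ ⁅ u ⁆

    dominates? : ∀ v u → Dec (Dominates v u)
    dominates? v u = (v ∈? S) ×-dec Vec.≡-dec Bool._≟_ (N G v ∩ ∁ S) ⁅ u ⁆

    -- The 0/1 matrix of the double count. Rows in `S` have at most one entry 1 and the other rows
    -- none (`row`); columns outside `S` have at least one (`column`).
    dom : Fin n → Fin n → Bool
    dom v u = does (dominates? v u)

    dom⁻ : ∀ {v u} → T (dom v u) → Dominates v u
    dom⁻ {v} {u} = does⇒ (dominates? v u)

    dom⁺ : ∀ {v u} → Dominates v u → T (dom v u)
    dom⁺ {v} {u} d = subst T (sym (dec-true (dominates? v u) d)) tt

    dominated-unique : ∀ {v u w} → Dominates v u → Adj G v w → w ∈ ∁ S → w ≡ u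
    dominated-unique {u = u} (_ , eq) vw w∈∁ =
      x∈⁅y⁆⇒x≡y u (subst (_ ∈_) eq (x∈p∩q⁺ (∈-tabulate⁺ vw , w∈∁)))

    dominates⇒ : ∀ {v u} → Dominates v u → Adj G v u × u ∈ ∁ S
    dominates⇒ {v} {u} (_ , eq)
      with u∈N , u∈∁ ← x∈p∩q⁻ (N G v) (∁ S) (subst (u ∈_) (sym eq) (x∈⁅x⁆ u)) =
      ∈-tabulate⁻ u∈N , u∈∁

    ∉S⇒∈∁ : ∀ {u} → T (not (inS u)) → u ∈ ∁ S
    ∉S⇒∈∁ {u} h = x∉p⇒x∈∁p λ u∈S → neg (∈⇒T u∈S) h
      where
      neg : ∀ {b} → T b → ¬ T (not b)
      neg {true} _ ()

    row : ∀ v → count (dom v) ≤ 𝟙 (inS v)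
    row v with inS v in eq
    ... | true  = count≤1 (dom v) λ hx hy →
      let y∈N , y∈∁ = dominates⇒ (dom⁻ hy) in sym (dominated-unique (dom⁻ hx) y∈N y∈∁)
    ... | false = ≮⇒≥ λ h → let u , hu = count>0⇒∃ (dom v) h in
      subst T eq (∈⇒T (proj₁ (dom⁻ {v} {u} hu)))

    column : ∀ u → 𝟙 (not (inS u)) ≤ count (λ v → dom v u)
    column u with not (inS u) in eq
    ... | false = z≤n
    ... | true  = ∃⇒count>0 (λ v → dom v u)
      (dom⁺ (proj₂ (proj₁ (esd u (∉S⇒∈∁ (subst T (sym eq) tt))))))

    ΣΣ-swap : sum (λ v → count (dom v)) ≡ sum (λ u → count (λ v → dom v u))
    ΣΣ-swap = ∑-comm (λ v u → 𝟙 (dom v u))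

    outside≤ΣΣ : count (not ∘ inS) ≤ sum (λ v → count (dom v))
    outside≤ΣΣ = ≤-trans (sum-mono-≤ column) (≤-reflexive (sym ΣΣ-swap))

    ΣΣ≤inside : sum (λ v → count (dom v)) ≤ count inS
    ΣΣ≤inside = sum-mono-≤ row

  n≤2∣ESD∣ : n ≤ ∣ S ∣ + ∣ S ∣
  n≤2∣ESD∣ = begin
    n                             ≡⟨ count+count-not inS ⟨
    count inS + count (not ∘ inS) ≤⟨ +-monoʳ-≤ (count inS) (≤-trans outside≤ΣΣ ΣΣ≤inside) ⟩
    count inS + count inS         ≡⟨ cong₂ _+_ (∣p∣≡count S) (∣p∣≡count S) ⟨
    ∣ S ∣ + ∣ S ∣                 ∎
    where open ≤-Reasoning

  -- When ∣ S ∣ = ∣ ∁ S ∣, both inequalities of the double count of the pairs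
  -- in Dominates are equalities, so Dominates is a bijection from S to ∁ S.
  ESD⇒Matched : ∣ S ∣ + ∣ S ∣ ≤ n → Matched G (colourOf ∘ inS)
  ESD⇒Matched 2∣S∣≤n = record
    { biMatching      = record { mate = mate ; unique = unique }
    ; amberNeighbours = amberNeighbours
    }
    where
    c : Colouring n
    c = colourOf ∘ inS

    inside≤outside : count inS ≤ count (not ∘ inS)
    inside≤outside = +-cancelˡ-≤ (count inS) _ _ (begin
      count inS + count inS         ≡⟨ cong₂ _+_ (∣p∣≡count S) (∣p∣≡count S) ⟨
      ∣ S ∣ + ∣ S ∣                 ≤⟨ 2∣S∣≤n ⟩
      n                             ≡⟨ count+count-not inS ⟨
      count inS + count (not ∘ inS) ∎)
      where open ≤-Reasoning

    -- Tightness of `row`: a row in `S` has sum exactly 1.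
    dominates-some : ∀ v → inS v ≡ true → ∃[ u ] Dominates v u
    dominates-some v v∈S =
      let tight  = sum-tight row (≤-trans inside≤outside outside≤ΣΣ) v
          u , hu = count>0⇒∃ (dom v) (≤-reflexive (sym (trans tight (cong 𝟙 v∈S))))
      in u , dom⁻ hu

    -- Tightness of `column`: a column outside `S` has sum exactly 1.
    dominator-unique : ∀ {u v w} → inS u ≡ false → Dominates v u → Dominates w u → v ≡ w
    dominator-unique {u} {v} {w} u∉S vu wu with v Fin.≟ w
    ... | yes v≡w = v≡w
    ... | no  v≢w = contradiction
      (∃≢⇒count>1 (λ x → dom x u) v≢w (dom⁺ vu) (dom⁺ wu))
      (≤⇒≯ (≤-reflexive (trans (sym tight) (cong (𝟙 ∘ not) u∉S))))
      where
      tight = sum-tight column (≤-trans (≤-reflexive (sym ΣΣ-swap))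
        (≤-trans ΣΣ≤inside inside≤outside)) u

    ∈∁⇒false : ∀ {u} → u ∈ ∁ S → inS u ≡ false
    ∈∁⇒false {u} u∈∁ with inS u in eq
    ... | false = refl
    ... | true  = contradiction (T⇒∈ (subst T (sym eq) tt)) (x∈∁p⇒x∉p u∈∁)

    false⇒∈∁ : ∀ {u} → inS u ≡ false → u ∈ ∁ S
    false⇒∈∁ eq = ∉S⇒∈∁ (subst (T ∘ not) (sym eq) tt)

    mate : ∀ u → ∃[ v ] BiAdj G c u v
    mate u with inS u in eq
    mate u | true =
      let v , uv     = dominates-some u eq
          adj , v∈∁  = dominates⇒ uv
      in v , adj , λ h → case trans h (cong colourOf (∈∁⇒false v∈∁)) of λ ()
    mate u | false =
      let (v , vu) , _ = esd u (false⇒∈∁ eq)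
      in v , Adj-sym G (proj₁ (dominates⇒ vu)) , λ h →
           case trans h (cong colourOf (Equivalence.to T-≡ (∈⇒T (proj₁ vu)))) of λ ()

    -- By `dominates-some`, `v` has exactly one neighbour outside `S`, which must be `u`. Hence
    -- every bicoloured edge is a domination pair.
    dominates : ∀ {v u} → inS v ≡ true → inS u ≡ false → Adj G v u → Dominates v u
    dominates v∈S u∉S vu with w , vw ← dominates-some _ v∈S
      with refl ← dominated-unique vw vu (false⇒∈∁ u∉S) = vw

    unique : ∀ u v w → BiAdj G c u v → BiAdj G c u w → v ≡ w
    unique u v w (uv , cv) (uw , cw) with inS u in pu | inS v in pv | inS w in pw
    ... | true  | true  | _     = contradiction refl cv
    ... | true  | false | true  = contradiction refl cw
    ... | false | false | _     = contradiction refl cv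
    ... | false | true  | false = contradiction refl cw
    ... | true  | false | false =
      let _ , ud = dominates-some u pu
      in trans (dominated-unique ud uv (false⇒∈∁ pv)) (sym (dominated-unique ud uw (false⇒∈∁ pw)))
    ... | false | true  | true  =
      dominator-unique pu (dominates pv pu (Adj-sym G uv)) (dominates pw pu (Adj-sym G uw))

    -- The degree condition gives a neighbour `z` other than the dominator `v` of `u`. If `z` were
    -- in `S`, it would be a second dominator of `u`.
    amberNeighbours : AmberNeighbours G c
    amberNeighbours u cu with inS u in pu
    ... | false with esd u (false⇒∈∁ pu)
    ... | (v , vu) , 2≤deg
      with count>1⇒∃≢ (adj G u) (subst (2 ≤_) (∣tabulate∣≡count (adj G u)) 2≤deg) v
    ... | z , z≢v , uz with inS z in pz
    ... | false = z , cong colourOf pz , uz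
    ... | true  = contradiction (dominator-unique pu (dominates pz pu (Adj-sym G uz)) vu) z≢v

-- A spanning member of `𝒯` in a matched graph.

module _ {n} {G : Graph n} {c : Colouring n} (M : Matched G c) where
  open Matched M

  private
    other-than-amber : ∀ {x y} → x ≡ amber → x ≢ y → y ≡ blue
    other-than-amber {y = amber} refl x≢y = contradiction refl x≢y
    other-than-amber {y = blue}  _    _   = refl

    other-than-blue : ∀ {x y} → x ≡ blue → x ≢ y → y ≡ amber
    other-than-blue {y = blue}  refl x≢y = contradiction refl x≢y
    other-than-blue {y = amber} _    _   = refl

    colours-differ : ∀ {u v} → c u ≡ amber → c v ≡ blue → c u ≢ c v
    colours-differ cu cv eq with () ← trans (sym cu) (trans eq cv)

    Agrees : ∀ {k} {H : Graph k} → Embedding H G → Colouring k → Set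
    Agrees e d = ∀ x → d x ≡ c (to e x)

    -- Covered vertices form a union of matching edges. Thus the mate of an uncovered vertex is
    -- uncovered too, which keeps the added paths disjoint from what is covered.
    MateClosed : ∀ {k} {H : Graph k} → Embedding H G → Set
    MateClosed e = ∀ x → Covers e (μ (to e x))

    Spans𝒯 : ∀ {k} (H : Graph k) → Embedding H G → Set
    Spans𝒯 H e = ∃[ d ] (𝒯 H d × Agrees e d × MateClosed e)

    uncovered-mate : ∀ {k} {H : Graph k} (e : Embedding H G) → MateClosed e →
                     ∀ {w} → ¬ Covers e w → ¬ Covers e (μ w)
    uncovered-mate e closed {w} ¬w (x , eq) =
      ¬w (subst (Covers e) (trans (cong μ eq) (sym (μ-involutive w))) (closed x))

    module _ {k l} {H : Graph k} {K : Graph l} (e : Embedding H G) (f : Embedding K G)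
             (disjoint : ∀ j → ¬ Covers e (to f j)) (x : Fin k) (y : Fin l)
             (edge : Adj G (to e x) (to f y)) where

      join-Agrees : ∀ {d d′} → Agrees e d → Agrees f d′ →
                    Agrees (joinEmbedding e f disjoint x y edge) (d ⊕ d′)
      join-Agrees ad ad′ u with splitAt k u
      ... | inj₁ a = ad a
      ... | inj₂ b = ad′ b

      join-MateClosed : MateClosed e → MateClosed f →
                        MateClosed (joinEmbedding e f disjoint x y edge)
      join-MateClosed cl cl′ u with splitAt k u
      ... | inj₁ a = let b , eq = cl a in
        b ↑ˡ l , trans (cong [ to e , to f ]′ (splitAt-↑ˡ k b l)) eq
      ... | inj₂ a = let b , eq = cl′ a in
        k ↑ʳ b , trans (cong [ to e , to f ]′ (splitAt-↑ʳ k l b)) eq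

    module Pair {a b} (ca : c a ≡ amber) (cb : c b ≡ blue) (ab : Adj G a b) where

      embedding : Embedding (path 2) G
      embedding = record
        { to        = Vec.lookup (a ∷ b ∷ [])
        ; injective = inj
        ; hom       = λ {u} {v} → hom′ u v
        }
        where
        inj : Injective _≡_ _≡_ (Vec.lookup (a ∷ b ∷ []))
        inj {0F} {0F} _  = refl
        inj {0F} {1F} eq = contradiction (cong c eq) (colours-differ ca cb)
        inj {1F} {0F} eq = contradiction (cong c (sym eq)) (colours-differ ca cb)
        inj {1F} {1F} _  = refl
        hom′ : ∀ u v → Adj (path 2) u v →
               Adj G (Vec.lookup (a ∷ b ∷ []) u) (Vec.lookup (a ∷ b ∷ []) v)
        hom′ 0F 1F _ = ab
        hom′ 1F 0F _ = Adj-sym G ab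
        hom′ 1F 1F ()

      agrees : Agrees embedding colour₂
      agrees 0F = sym ca
      agrees 1F = sym cb

      mateClosed : MateClosed embedding
      mateClosed 0F = 1F , μ-unique (ab , colours-differ ca cb)
      mateClosed 1F = 0F , μ-unique (Adj-sym G ab , colours-differ ca cb ∘ sym)

    -- An amber edge with both mates attached, used both as the initial `P₄` and as the path added
    -- by `O₂`.
    module Quad {a z} (ca : c a ≡ amber) (cz : c z ≡ amber) (az : Adj G a z) where

      vertex : Fin 4 → Fin n
      vertex = Vec.lookup (μ a ∷ a ∷ z ∷ μ z ∷ [])

      colour-vertex : ∀ x → colour₄ x ≡ c (vertex x)
      colour-vertex 0F = sym (other-than-amber ca (proj₂ (μ-adj a)))
      colour-vertex 1F = sym ca
      colour-vertex 2F = sym cz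
      colour-vertex 3F = sym (other-than-amber cz (proj₂ (μ-adj z)))

      a≢z : a ≢ z
      a≢z refl = Adj-irrefl G az

      μa≢μz : μ a ≢ μ z
      μa≢μz = a≢z ∘ μ-injective

      embedding : Embedding (path 4) G
      embedding = record
        { to        = vertex
        -- Equal images have equal colours, so only the two amber vertices and the two blue ones
        -- have to be told apart.
        ; injective = λ {u} {v} eq →
            inj u v (trans (colour-vertex u) (trans (cong c eq) (sym (colour-vertex v)))) eq
        ; hom       = λ {u} {v} → hom′ u v
        }
        where
        inj : ∀ u v → colour₄ u ≡ colour₄ v → vertex u ≡ vertex v → u ≡ v
        inj 0F 0F _ _  = refl
        inj 0F 3F _ eq = contradiction eq μa≢μz
        inj 1F 1F _ _  = refl
        inj 1F 2F _ eq = contradiction eq a≢z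
        inj 1F 3F ()
        inj 2F 1F _ eq = contradiction (sym eq) a≢z
        inj 2F 2F _ _  = refl
        inj 2F 3F ()
        inj 3F 0F _ eq = contradiction (sym eq) μa≢μz
        inj 3F 3F _ _  = refl
        hom′ : ∀ u v → Adj (path 4) u v → Adj G (vertex u) (vertex v)
        hom′ 0F 1F _ = Adj-sym G (proj₁ (μ-adj a))
        hom′ 1F 0F _ = proj₁ (μ-adj a)
        hom′ 1F 2F _ = az
        hom′ 2F 1F _ = Adj-sym G az
        hom′ 2F 3F _ = proj₁ (μ-adj z)
        hom′ 3F 2F _ = Adj-sym G (proj₁ (μ-adj z))
        hom′ 3F 3F ()

      agrees : Agrees embedding colour₄
      agrees = colour-vertex

      mateClosed : MateClosed embedding
      mateClosed 0F = 1F , μ-involutive a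
      mateClosed 1F = 0F , refl
      mateClosed 2F = 3F , refl
      mateClosed 3F = 2F , μ-involutive z

    module _ {k} {H : Graph k} (e : Embedding H G) {d} (t : 𝒯 H d)
             (agree : Agrees e d) (closed : MateClosed e) where

      Enlargement : Set
      Enlargement = ∃[ l ] (k < l × ∃[ H′ ] Σ (Embedding {l} H′ G) (Spans𝒯 H′))

      enlarge-O₁ : ∀ {a b} (ca : c a ≡ amber) (cb : c b ≡ blue) (ab : Adj G a b) →
                   ∀ x → c (to e x) ≡ amber → Adj G (to e x) a →
                   ¬ Covers e a → ¬ Covers e b → Enlargement
      enlarge-O₁ ca cb ab x cx xa ¬a ¬b =
        k + 2 , m<m+n k (s≤s z≤n) , join H x (path 2) 0F ,
        joinEmbedding e P.embedding disjoint x 0F xa ,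
        d ⊕ colour₂ , O₁ x 0F (trans (agree x) cx) refl t ,
        join-Agrees e P.embedding disjoint x 0F xa agree P.agrees ,
        join-MateClosed e P.embedding disjoint x 0F xa closed P.mateClosed
        where
        module P = Pair ca cb ab
        disjoint : ∀ j → ¬ Covers e (to P.embedding j)
        disjoint 0F = ¬a
        disjoint 1F = ¬b

      enlarge-O₂ : ∀ {a z} (ca : c a ≡ amber) (cz : c z ≡ amber) (az : Adj G a z) →
                   ∀ x → c (to e x) ≡ blue → Adj G (to e x) (μ a) →
                   ¬ Covers e a → ¬ Covers e z → Enlargement
      enlarge-O₂ ca cz az x cx xμa ¬a ¬z =
        k + 4 , m<m+n k (s≤s z≤n) , join H x (path 4) 0F ,
        joinEmbedding e Q.embedding disjoint x 0F xμa ,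
        d ⊕ colour₄ , O₂ x 0F (trans (agree x) cx) refl t ,
        join-Agrees e Q.embedding disjoint x 0F xμa agree Q.agrees ,
        join-MateClosed e Q.embedding disjoint x 0F xμa closed Q.mateClosed
        where
        module Q = Quad ca cz az
        disjoint : ∀ j → ¬ Covers e (to Q.embedding j)
        disjoint 0F = uncovered-mate e closed ¬a
        disjoint 1F = ¬a
        disjoint 2F = ¬z
        disjoint 3F = uncovered-mate e closed ¬z

      mate-covered : ∀ x {w} → BiAdj G c (to e x) w → Covers e w
      mate-covered x xw = subst (Covers e) (sym (μ-unique xw)) (closed x)

      enlarge : ∀ x w → Adj G (to e x) w → ¬ Covers e w → Enlargement
      enlarge x w xw ¬w with c (to e x) in cx | c w in cw
      -- A bicoloured edge would make `w` the mate of a covered vertex, hence covered.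
      ... | amber | blue  = contradiction (mate-covered x (xw , colours-differ cx cw)) ¬w
      ... | blue  | amber =
        contradiction (mate-covered x (xw , colours-differ cw cx ∘ sym)) ¬w
      ... | amber | amber =
        enlarge-O₁ cw (other-than-amber cw (proj₂ (μ-adj w))) (proj₁ (μ-adj w))
          x cx xw ¬w (uncovered-mate e closed ¬w)
      ... | blue  | blue with other-than-blue cw (proj₂ (μ-adj w))
      ... | cμw with amberNeighbours (μ w) cμw
      ... | z , cz , μwz with covers? e z
      -- The pair is attached at `z` instead of `x`, so the edge from `x` to `w` is left out of the
      -- subgraph.
      ... | yes (x′ , refl) =
        enlarge-O₁ cμw cw (Adj-sym G (proj₁ (μ-adj w)))
          x′ cz (Adj-sym G μwz) (uncovered-mate e closed ¬w) ¬w
      ... | no ¬z =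
        enlarge-O₂ cμw cz μwz
          -- With `a = μ w`, the leaf `μ a` to be attached is `w` itself.
          x cx (subst (Adj G (to e x)) (μ-involutive w) xw) (uncovered-mate e closed ¬w) ¬z

    amber-vertex : Fin n → ∃[ a ] c a ≡ amber
    amber-vertex v with c v in cv
    ... | amber = v , cv
    ... | blue  = μ v , other-than-blue cv (proj₂ (μ-adj v))

  -- The spanning member of `𝒯` has degree sum `k + k - 2` with `n ≤ k`, at least that of `G`. Its
  -- embedding is therefore tight and, being onto, an isomorphism.
  minimal-size⇒𝒯 : Connected G → degreeSum G + 2 ≤ n + n → 𝒯 G c
  minimal-size⇒𝒯 conn@(1≤n , _) tight
    with a , ca ← amber-vertex (Fin.fromℕ< 1≤n)
    with z , cz , az ← amberNeighbours a ca
    with k , H , e , (d , t , agree , _) , cov ←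
      spanning G Spans𝒯 conn (λ { e (d , t , ad , cl) → enlarge e t ad cl })
        (Quad.embedding ca cz az) 0F
        (colour₄ , base , Quad.agrees ca cz az , Quad.mateClosed ca cz az)
    = iso record
      { bijection        = mk↔ₛ′ (to e) (proj₁ ∘ cov) (proj₂ ∘ cov)
                             (λ x → injective e (proj₂ (cov (to e x))))
      ; preserves-adj    = degreeSum-tight e (+-cancelʳ-≤ 2 _ _ (begin
          degreeSum G + 2 ≤⟨ tight ⟩
          n + n           ≤⟨ +-mono-≤ (covers-all⇒n≤k e cov) (covers-all⇒n≤k e cov) ⟩
          k + k           ≡⟨ 𝒯⇒degreeSum+2≡2n t ⟨
          degreeSum H + 2 ∎))
      ; preserves-colour = agree
      } t
    where open ≤-Reasoning

-- Arithmetic and conclusion.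

m+m≤n+n⇒m≤n : ∀ {m n} → m + m ≤ n + n → m ≤ n
m+m≤n+n⇒m≤n h = ≮⇒≥ λ n<m → <⇒≱ (+-mono-< n<m n<m) h

[m+1]+2g≡m+[2g+1] : ∀ m g → (m + 1) + (g + g) ≡ m + (g + g + 1)
[m+1]+2g≡m+[2g+1] = solve-∀

-- Two inequalities whose sum is an equality are both equalities.
tight-sum : ∀ {m g n} → n ≤ m + 1 → n ≤ g + g → m + (g + g + 1) ≡ n + n →
            m + 1 ≡ n × g + g ≡ n
tight-sum {m} {g} {n} n≤m+1 n≤2g eq =
  ≤-antisym (+-cancelʳ-≤ (g + g) _ _ (≤-trans (≤-reflexive eq′) (+-monoʳ-≤ n n≤2g))) n≤m+1 ,
  ≤-antisym (+-cancelˡ-≤ (m + 1) _ _ (≤-trans (≤-reflexive eq′) (+-monoˡ-≤ n n≤m+1))) n≤2g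
  where
  eq′ : (m + 1) + (g + g) ≡ n + n
  eq′ = trans ([m+1]+2g≡m+[2g+1] m g) eq

open import Data.Integer using (+_; _*_; _-_; _≥_)
import Data.Integer as ℤ
import Data.Integer.Properties as ℤ
import Data.Integer.Tactic.RingSolver as ℤ-Solver

-- Adding `g + g + 1` removes the subtractions, so the integer claims reduce to comparing
-- `m + (g + g + 1)` with `n + n` in the naturals.
bound-shift : ∀ n g → (+ 2 * (n - g) - + 1) ℤ.+ (g ℤ.+ g ℤ.+ + 1) ≡ n ℤ.+ n
bound-shift = ℤ-Solver.solve-∀

i+k-k≡i : ∀ i k → (i ℤ.+ k) - k ≡ i
i+k-k≡i = ℤ-Solver.solve-∀

i+k≤j+k⇒i≤j : ∀ k i j → i ℤ.+ k ℤ.≤ j ℤ.+ k → i ℤ.≤ j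
i+k≤j+k⇒i≤j k i j h =
  subst₂ ℤ._≤_ (i+k-k≡i i k) (i+k-k≡i j k) (ℤ.+-monoˡ-≤ (ℤ.- k) h)

theorem5p2 : (n : ℕ) (G : Graph n) → Connected G →
    (+ size G ≥ + 2 * (+ n - + γesp G) - + 1) ×
    ((+ size G ≡ + 2 * (+ n - + γesp G) - + 1) ⇔ (IsTree G × ∃[ c ] 𝒯 G c))
theorem5p2 n G conn
  -- This match replaces `γesp G` by the size of a concrete minimum ESD-set `S`.
  with minESD G
... | γ , (S , esd , refl) , least = bound , mk⇔ extremal⇒𝒯 𝒯⇒extremal
  where
  m = size G
  slack = γ + γ + 1
  rhs = + 2 * (+ n - + γ) - + 1

  deg≡ : degreeSum G + 2 ≡ (m + 1) + (m + 1)
  deg≡ = trans (cong (_+ 2) (degreeSum≡2size G)) (lem m)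
    where
    lem : ∀ m → m + m + 2 ≡ (m + 1) + (m + 1)
    lem = solve-∀

  n≤m+1 : n ≤ m + 1
  n≤m+1 = m+m≤n+n⇒m≤n (≤-trans (connected⇒2n≤degreeSum+2 G conn) (≤-reflexive deg≡))

  n≤2γ : n ≤ γ + γ
  n≤2γ = n≤2∣ESD∣ {G = G} esd

  bound : + m ≥ + 2 * (+ n - + γ) - + 1
  bound = i+k≤j+k⇒i≤j (+ slack) rhs (+ m)
    (subst (ℤ._≤ + (m + slack)) (sym (bound-shift (+ n) (+ γ)))
      (ℤ.+≤+ (≤-trans (+-mono-≤ n≤m+1 n≤2γ) (≤-reflexive ([m+1]+2g≡m+[2g+1] m γ)))))

  extremal⇒𝒯 : + m ≡ + 2 * (+ n - + γ) - + 1 → IsTree G × ∃[ c ] 𝒯 G c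
  extremal⇒𝒯 eq = (conn , minimal-size⇒acyclic G conn small) ,
    _ , minimal-size⇒𝒯 (ESD⇒Matched esd (≤-reflexive (proj₂ tight))) conn small
    where
    tight = tight-sum {m} {γ} n≤m+1 n≤2γ
      (ℤ.+-injective (trans (cong (ℤ._+ + slack) eq) (bound-shift (+ n) (+ γ))))
    small : degreeSum G + 2 ≤ n + n
    small = ≤-reflexive (trans deg≡ (cong (λ k → k + k) (proj₁ tight)))

  𝒯⇒extremal : IsTree G × ∃[ c ] 𝒯 G c → + m ≡ + 2 * (+ n - + γ) - + 1
  𝒯⇒extremal (_ , c , t) with k , 2k≤n , hasESD ← Matched⇒ESD (𝒯⇒Matched t) =
    trans (sym (i+k-k≡i (+ m) (+ slack)))
      (trans (cong (_- + slack) (trans (cong +_ m+slack≡2n) (sym (bound-shift (+ n) (+ γ)))))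
        (i+k-k≡i rhs (+ slack)))
    where
    -- Minimality compares `γ` with the size `k` of the blue ESD-set, which is at most half of `n`.
    2γ≡n : γ + γ ≡ n
    2γ≡n = ≤-antisym (≤-trans (+-mono-≤ (least k hasESD) (least k hasESD)) 2k≤n) n≤2γ
    m+1≡n : m + 1 ≡ n
    m+1≡n = ≤-antisym
      (m+m≤n+n⇒m≤n (≤-reflexive (trans (sym deg≡) (𝒯⇒degreeSum+2≡2n t)))) n≤m+1
    m+slack≡2n : m + slack ≡ n + n
    m+slack≡2n = trans (sym ([m+1]+2g≡m+[2g+1] m γ)) (cong₂ _+_ m+1≡n 2γ≡n)
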